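{- Let $k\ge 3$ and $n\ge 2$ be integers. Then $\mathcal{B}(k,n)\le \binom{k}{2}-1$.
   Context: An orthogonal array $\mathrm{OA}(k,n)$ on an alphabet $\Lambda$ with $|\Lambda|=n$ is an $n^2\times k$ matrix $A=(a_{r\ell})$ with entries in $\Lambda$ such that in every pair of distinct columns each ordered pair in $\Lambda^2$ occurs in exactly one row. For distinct columns $c,i,j\in\{1,\dots,k\}$ and $s\in\Lambda$, let $\rho_s(c,i,j)$ be the permutation of $\Lambda$ mapping $a_{ri}\mapsto a_{rj}$ for all rows $r$ with $a_{rc}=s$. With $\pi(\gamma)\in\mathbb{Z}_2$ denoting the parity of a permutation $\gamma$ ($0$ for even, $1$ for odd), define $\tau^c_{ij}(A)=\sum_{s\in\Lambda}\pi(\rho_s(c,i,j))\in\mathbb{Z}_2$. The $\tau$-parity of $A$ is the vector $(\tau^c_{ij}(A))$ indexed by the $k(k-1)(k-2)$ ordered triples $(c,i,j)$ of distinct elements of $\{1,\dots,k\}$. $\mathcal{B}(k,n)$ denotes $\log_2$ of the number of different $\tau$-parities achieved by orthogonal arrays $\mathrm{OA}(k,n)$ (on a fixed alphabet of size $n$); if no $\mathrm{OA}(k,n)$ exists we use the convention $\log_2 0=-\infty$. -}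

module Defs where

open import Algebra.Properties.Monoid.Sum using (sum)
open import Data.Fin as Fin using (Fin)
open import Data.Fin.Permutation using (Permutation′; permutation; _⟨$⟩ʳ_)
import Data.Fin.Properties as Fin
open import Data.Integer as ℤ using (ℤ; +_; -[1+_])
open import Data.List using (List; []; _∷_; allFin; cartesianProduct; cartesianProductWith; deduplicate; filter; length; map; mapMaybe)
open import Data.List.Membership.Propositional using (_∈_)
open import Data.List.Membership.Propositional.Properties using (∈-allFin; ∈-cartesianProductWith⁺)
open import Data.List.Relation.Unary.Any using (here)
open import Data.Maybe as Maybe using ()
open import Data.Nat using (ℕ; zero; suc; parity; _*_; _^_; _<_)
open import Data.Parity using (Parity)
import Data.Parity.Properties as ℙ
open import Data.Product using (Σ; ∃!; _×_; _,_; proj₁; proj₂)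
open import Data.Rational as ℚ using (ℚ; ↥_; ↧ₙ_)
open import Data.Vec as Vec using (Vec; lookup)
open import Function using (_∘_)
open import Level using (0ℓ)
open import Relation.Binary using (Rel; Decidable)
open import Relation.Binary.PropositionalEquality using (_≡_; _≢_; refl; sym; cong; subst)
open import Relation.Nullary using (Dec; yes; no; ¬_; ¬?; contradiction; _×-dec_; _→-dec_)
open import Relation.Nullary.Decidable using (map′; dec⇒maybe)
open import Relation.Unary as Unary using (Pred; _⊆_)

-- The parity of the number of inversions.
π : ∀ {n} → Permutation′ n → Parity
π {n} γ = parity (length (filter inverted? (cartesianProduct (allFin n) (allFin n))))
  where
  inverted? : Unary.Decidable λ (x , y) → x Fin.< y × (γ ⟨$⟩ʳ y) Fin.< (γ ⟨$⟩ʳ x)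
  inverted? (x , y) = (x Fin.<? y) ×-dec ((γ ⟨$⟩ʳ y) Fin.<? (γ ⟨$⟩ʳ x))

-- Matrices are vectors of rows; the alphabet Λ is Fin n.
Matrix : ℕ → ℕ → Set
Matrix k n = Vec (Vec (Fin n) k) (n ^ 2)

entry : ∀ {k n} → Matrix k n → Fin (n ^ 2) → Fin k → Fin n
entry A r ℓ = lookup (lookup A r) ℓ

IsOA : ∀ {k n} → Matrix k n → Set
IsOA {k} {n} A = (i j : Fin k) → i ≢ j → (x y : Fin n) →
  ∃! _≡_ λ r → entry A r i ≡ x × entry A r j ≡ y

OA : ℕ → ℕ → Set
OA k n = Σ (Matrix k n) IsOA

record Triple (k : ℕ) : Set where
  constructor triple
  field
    c i j : Fin k
    c≢i   : c ≢ i
    c≢j   : c ≢ j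
    i≢j   : i ≢ j

module _ {k n : ℕ} (A : OA k n) where

  -- rowAt c i c≢i s x is the unique row r with a_rc = s and a_ri = x.
  rowAt : (c i : Fin k) → c ≢ i → Fin n → Fin n → Fin (n ^ 2)
  rowAt c i c≢i s x = proj₁ (proj₂ A c i c≢i s x)

  ρ : Fin n → Triple k → Permutation′ n
  ρ s (triple c i j c≢i c≢j _) =
    permutation (image i j c≢i) (image j i c≢j)
      (image-inverse j i c≢j c≢i) (image-inverse i j c≢i c≢j)
    where
    image : (i j : Fin k) → c ≢ i → Fin n → Fin n
    image i j c≢i x = entry (proj₁ A) (rowAt c i c≢i s x) j

    image-inverse : ∀ i j (c≢i : c ≢ i) (c≢j : c ≢ j) x →
      image j i c≢j (image i j c≢i x) ≡ x
    image-inverse i j c≢i c≢j x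
      with proj₂ A c i c≢i s x
    ... | r , (rc≡s , ri≡x) , _
      with proj₂ A c j c≢j s (entry (proj₁ A) r j)
    ... | r′ , _ , unique = subst (λ r″ → entry (proj₁ A) r″ i ≡ x) (sym (unique (rc≡s , refl))) ri≡x

  τ : Triple k → Parity
  τ t = sum ℙ.+-0-monoid λ (s : Fin n) → π (ρ s t)

TauParity : ℕ → Set
TauParity k = Triple k → Parity

_≈_ : ∀ {k} → Rel (TauParity k) 0ℓ
f ≈ g = ∀ t → f t ≡ g t

-- Negations are definitionally proof-irrelevant, so one proof p stands for all.
∀¬? : ∀ {P : Set} {Q : ¬ P → Set} → Dec (¬ P) → (∀ p → Dec (Q p)) → Dec (∀ p → Q p)
∀¬? {Q = Q} (yes p) Q? = map′ {A = Q p} (λ q _ → q) (λ h → h p) (Q? p)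
∀¬? (no ¬¬p)       Q? = yes λ p → contradiction p ¬¬p

_≈?_ : ∀ {k} → Decidable (_≈_ {k})
f ≈? g = map′
  (λ h (triple c i j p q r) → h c i j p q r)
  (λ h c i j p q r → h (triple c i j p q r))
  (Fin.all? λ c → Fin.all? λ i → Fin.all? λ j →
    ∀¬? (¬? (c Fin.≟ i)) λ p → ∀¬? (¬? (c Fin.≟ j)) λ q → ∀¬? (¬? (i Fin.≟ j)) λ r →
    f (triple c i j p q r) ℙ.≟ g (triple c i j p q r))

∃!? : ∀ {m} {P : Pred (Fin m) 0ℓ} → Unary.Decidable P → Dec (∃! _≡_ P)
∃!? P? = map′
  (λ (r , p , u) → r , p , λ {r′} → u r′)
  (λ (r , p , u) → r , p , λ r′ → u {r′})
  (Fin.any? λ r → P? r ×-dec Fin.all? λ r′ → P? r′ →-dec (r Fin.≟ r′))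

isOA? : ∀ {k n} → Unary.Decidable (IsOA {k} {n})
isOA? A = Fin.all? λ i → Fin.all? λ j → ¬? (i Fin.≟ j) →-dec
  (Fin.all? λ x → Fin.all? λ y →
    ∃!? λ r → (entry A r i Fin.≟ x) ×-dec (entry A r j Fin.≟ y))

vectors : ∀ {A : Set} → List A → (m : ℕ) → List (Vec A m)
vectors xs zero    = Vec.[] ∷ []
vectors xs (suc m) = cartesianProductWith Vec._∷_ xs (vectors xs m)

∈-vectors : ∀ {A : Set} {xs : List A} → (∀ x → x ∈ xs) → ∀ {m} (v : Vec A m) → v ∈ vectors xs m
∈-vectors all∈ Vec.[]       = here refl
∈-vectors all∈ (x Vec.∷ v) = ∈-cartesianProductWith⁺ Vec._∷_ (all∈ x) (∈-vectors all∈ v)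

matrices : ∀ k n → List (Matrix k n)
matrices k n = vectors (vectors (allFin n) k) (n ^ 2)

∈-matrices : ∀ {k n} (A : Matrix k n) → A ∈ matrices k n
∈-matrices = ∈-vectors (∈-vectors ∈-allFin)

-- Each orthogonal array occurs with a single proof of IsOA; τ does not depend
-- on the choice, because that proof only supplies the (unique) rows.
orthogonalArrays : ∀ k n → List (OA k n)
orthogonalArrays k n = mapMaybe (λ A → Maybe.map (A ,_) (dec⇒maybe (isOA? A))) (matrices k n)

#τ-parities : ℕ → ℕ → ℕ
#τ-parities k n = length (deduplicate _≈?_ (map τ (orthogonalArrays k n)))

-- An extended real x ∈ [-∞,∞] is represented by its lower cut {q ∈ ℚ ∣ q < x};
-- the empty cut is -∞, and the order is inclusion of cuts.
LowerReal : Set₁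
LowerReal = Pred ℚ 0ℓ

_≤ᴸ_ : Rel LowerReal 0ℓ
x ≤ᴸ y = x ⊆ y

fromℤ : ℤ → LowerReal
fromℤ z q = q ℚ.< z ℚ./ 1

-- For d > 0, a / d < log₂ N means 2 ^ a < N ^ d; a negative power of two is
-- moved to the other side.  No q satisfies this for N = 0, so log₂ 0 = -∞.
log₂ : ℕ → LowerReal
log₂ N q = cut (↥ q)
  where
  cut : ℤ → Set
  cut (+ a)    = 2 ^ a < N ^ ↧ₙ q
  cut -[1+ a ] = 1 < 2 ^ suc a * N ^ ↧ₙ q

𝓑 : ℕ → ℕ → LowerReal
𝓑 k n = log₂ (#τ-parities k n)

{-# OPTIONS --safe #-}
module Submission where

-- Let L_ij be the order of the rows by column i with ties broken by column j,
-- and let d(E, F) ∈ ℤ₂ be the parity of the number of pairs ordered differently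
-- by E and F; then d(F, G) = d(E, F) + d(E, G).  Since L_ci and L_cj disagree
-- exactly on the inversions of the permutations ρ_s(c, i, j), the parity τ^c_ij
-- is d(L_ci, L_cj) = h(c, i) + h(c, j) with h(a, b) = d(L_01, L_ab).  As
-- h(0, 1) = 0, and h(a, b) + h(b, a) = d(L_ab, L_ba) depends only on n, the
-- values h(a, b) with a < b and (a, b) ≠ (0, 1) determine the τ-parity.

open import Defs
open import Data.Integer using (+_; _-_)
open import Data.Nat using (ℕ; _≥_)
open import Data.Nat.Combinatorics using (_C_)

open import Algebra.Properties.Semiring.Sum using ()
open import Data.Bool using (true; false; if_then_else_)
open import Data.Fin as Fin using (Fin; zero; suc; _↑ˡ_; _↑ʳ_; combine; remQuot; funToFin; finToFun)
open import Data.Fin.Permutation using (Permutation; Permutation′; permutation; _⟨$⟩ʳ_)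
import Data.Fin.Properties as Fin
import Data.Integer as ℤ
import Data.Integer.Properties as ℤ
open import Data.List using (List; []; _∷_; _++_; allFin; cartesianProduct; deduplicate; drop; filter; length; lookup; map; tabulate)
open import Data.List.Membership.Propositional using (_∈_)
open import Data.List.Membership.Propositional.Properties using (∈-++⁺ˡ; ∈-++⁺ʳ; ∈-allFin; ∈-deduplicate⁻; ∈-lookup; ∈-map⁺; ∈-map⁻)
open import Data.List.Properties using (filter-++; length-++; length-map; length-tabulate)
open import Data.List.Relation.Unary.All as All using ()
open import Data.List.Relation.Unary.AllPairs using (AllPairs; _∷_)
open import Data.List.Relation.Unary.Any as Any using (here; there)
open import Data.List.Relation.Unary.Any.Properties using (lookup-index)
open import Data.List.Relation.Unary.Unique.DecSetoid.Properties using (deduplicate-!)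
open import Data.Nat as ℕ using (zero; suc; parity; _^_; s≤s; s<s)
import Data.Nat.Combinatorics as ℕ
import Data.Nat.Coprimality as Coprimality
import Data.Nat.Properties as ℕ
-- The library gives _*_ the same precedence as _+_.
open import Data.Parity using (Parity; 0ℙ; 1ℙ; _+_; _⁻¹) renaming (_*_ to infixl 7.5 _*_)
import Data.Parity.Properties as ℙ
open import Data.Product using (∃; _×_; _,_; proj₁; proj₂; uncurry)
open import Data.Rational as ℚ using (ℚ; mkℚ; *<*)
import Data.Rational.Properties as ℚ
open import Function using (_∘_)
open import Level using (0ℓ)
open import Relation.Binary using (DecSetoid; Rel; tri<; tri≈; tri>)
open import Relation.Binary.PropositionalEquality using (_≡_; _≢_; refl; sym; trans; cong; cong₂; subst; subst₂; module ≡-Reasoning)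
open import Relation.Nullary using (Dec; does; yes; no; ¬_; contradiction; _×-dec_)
open import Relation.Nullary.Decidable using (dec-true; dec-false)
open import Relation.Unary using (Pred; Decidable)

open Algebra.Properties.Semiring.Sum ℙ.+-*-semiring
open ≡-Reasoning

-- Indicators and finite sums over ℤ₂.

⟦_⟧ : ∀ {P : Set} → Dec P → Parity
⟦ d ⟧ = if does d then 1ℙ else 0ℙ

⟦⟧-yes : ∀ {P : Set} (d : Dec P) → P → ⟦ d ⟧ ≡ 1ℙ
⟦⟧-yes d p = cong (if_then 1ℙ else 0ℙ) (dec-true d p)

⟦⟧-no : ∀ {P : Set} (d : Dec P) → ¬ P → ⟦ d ⟧ ≡ 0ℙ
⟦⟧-no d ¬p = cong (if_then 1ℙ else 0ℙ) (dec-false d ¬p)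

⟦⟧-× : ∀ {P Q : Set} (d : Dec P) (e : Dec Q) → ⟦ d ×-dec e ⟧ ≡ ⟦ d ⟧ * ⟦ e ⟧
⟦⟧-× d e with does d
... | true  = refl
... | false = refl

lt : ∀ {n} → Fin n → Fin n → Parity
lt x y = ⟦ x Fin.<? y ⟧

δ : ∀ {n} → Fin n → Fin n → Parity
δ x y = ⟦ x Fin.≟ y ⟧

∑-δ : ∀ {n} (i : Fin n) (f : Fin n → Parity) → ∑[ j < n ] (δ i j * f j) ≡ f i
∑-δ {suc n} zero    f = trans (cong (_+_ (f zero)) (sum-replicate-zero n)) (ℙ.+-identityʳ (f zero))
∑-δ         (suc i) f = ∑-δ i (f ∘ suc)

∑∑-cong : ∀ {m n} {f g : Fin m → Fin n → Parity} → (∀ i j → f i j ≡ g i j) →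
  ∑[ i < m ] ∑[ j < n ] f i j ≡ ∑[ i < m ] ∑[ j < n ] g i j
∑∑-cong eq = sum-cong-≗ λ i → sum-cong-≗ (eq i)

∑∑-distrib-+ : ∀ {m n} (f g : Fin m → Fin n → Parity) →
  ∑[ i < m ] ∑[ j < n ] (f i j + g i j) ≡ ∑[ i < m ] ∑[ j < n ] f i j + ∑[ i < m ] ∑[ j < n ] g i j
∑∑-distrib-+ f g = trans (sum-cong-≗ λ i → ∑-distrib-+ (f i) (g i)) (∑-distrib-+ (sum ∘ f) (sum ∘ g))

-- Over ℤ₂ the terms at (i, j) and (j, i) cancel. The induction splits off the first row and the
-- first column, whose off-diagonal sums both equal `a`.
∑∑-symmetric : ∀ {n} (f : Fin n → Fin n → Parity) → (∀ i → f i i ≡ 0ℙ) → (∀ i j → f i j ≡ f j i) →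
  ∑[ i < n ] ∑[ j < n ] f i j ≡ 0ℙ
∑∑-symmetric {zero}  f diag symm = refl
∑∑-symmetric {suc n} f diag symm = begin
  f zero zero + a + ∑[ i < n ] (f (suc i) zero + sum (λ j → f (suc i) (suc j)))
    ≡⟨ cong₂ (λ p q → p + a + q) (diag zero) (∑-distrib-+ (λ i → f (suc i) zero) _) ⟩
  a + (∑[ i < n ] f (suc i) zero + ∑[ i < n ] ∑[ j < n ] f (suc i) (suc j))
    ≡⟨ cong₂ (λ p q → a + (p + q)) (sum-cong-≗ λ i → symm (suc i) zero)
         (∑∑-symmetric (λ i j → f (suc i) (suc j)) (diag ∘ suc) (λ i j → symm (suc i) (suc j))) ⟩
  a + (a + 0ℙ)
    ≡⟨ cong (_+_ a) (ℙ.+-identityʳ a) ⟩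
  a + a
    ≡⟨ ℙ.p+p≡0ℙ a ⟩
  0ℙ ∎
  where a = ∑[ j < n ] f zero (suc j)

sum-↑ : ∀ m n (f : Fin (m ℕ.+ n) → Parity) →
  sum f ≡ ∑[ i < m ] f (i ↑ˡ n) + ∑[ j < n ] f (m ↑ʳ j)
sum-↑ zero    n f = refl
sum-↑ (suc m) n f = trans (cong (_+_ (f zero)) (sum-↑ m n (f ∘ suc))) (sym (ℙ.+-assoc (f zero) _ _))

sum-combine : ∀ m n (f : Fin (m ℕ.* n) → Parity) →
  sum f ≡ ∑[ i < m ] ∑[ j < n ] f (combine i j)
sum-combine zero    n f = refl
sum-combine (suc m) n f = trans (sum-↑ n (m ℕ.* n) f)
  (cong (_+_ (∑[ j < n ] f (j ↑ˡ m ℕ.* n))) (sum-combine m n (f ∘ (n ↑ʳ_))))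

-- Composed with `remQuot` and `combine`, the mutually inverse `to` and `from` become a permutation,
-- under which `sum` is invariant.
∑∑-reindex : ∀ {m n k} (f : Fin k → Parity) (to : Fin m → Fin n → Fin k) (from : Fin k → Fin m × Fin n) →
  (∀ r → uncurry to (from r) ≡ r) → (∀ i j → from (to i j) ≡ (i , j)) →
  sum f ≡ ∑[ i < m ] ∑[ j < n ] f (to i j)
∑∑-reindex {m} {n} {k} f to from to-from from-to = begin
  sum f
    ≡⟨ sum-permute f σ ⟩
  sum (f ∘ uncurry to ∘ remQuot {m} n)
    ≡⟨ sum-combine m n (f ∘ uncurry to ∘ remQuot {m} n) ⟩
  ∑[ i < m ] ∑[ j < n ] f (uncurry to (remQuot {m} n (combine i j)))
    ≡⟨ ∑∑-cong (λ i j → cong (f ∘ uncurry to) (Fin.remQuot-combine i j)) ⟩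
  ∑[ i < m ] ∑[ j < n ] f (to i j) ∎
  where
  σ : Permutation (m ℕ.* n) k
  σ = permutation (uncurry to ∘ remQuot {m} n) (uncurry combine ∘ from)
    (λ r → trans (cong (uncurry to) (Fin.remQuot-combine _ _)) (to-from r))
    (λ i → trans (cong (uncurry combine) (from-to _ _)) (Fin.combine-remQuot {m} n i))

-- Permutation parity as a sum over pairs.

parity-filter-tabulate : ∀ {A B : Set} {P : Pred B _} (P? : Decidable P)
  {n} (f : A → B) (g : Fin n → A) →
  parity (length (filter P? (map f (tabulate g)))) ≡ ∑[ i < n ] ⟦ P? (f (g i)) ⟧
parity-filter-tabulate P? {zero}  f g = refl
parity-filter-tabulate P? {suc n} f g with does (P? (f (g zero)))
... | true  = trans (ℙ.+-homo-+ 1 (length (filter P? (map f (tabulate (g ∘ suc)))))) (cong _⁻¹ (parity-filter-tabulate P? f (g ∘ suc)))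
... | false = parity-filter-tabulate P? f (g ∘ suc)

-- Tabulated lists replace `allFin` to make the induction go through: the tail of `tabulate f` is
-- `tabulate (f ∘ suc)`.
parity-filter-cartesianProduct : ∀ {A B : Set} {P : Pred (A × B) _} (P? : Decidable P)
  {m n} (f : Fin m → A) (g : Fin n → B) →
  parity (length (filter P? (cartesianProduct (tabulate f) (tabulate g)))) ≡
  ∑[ i < m ] ∑[ j < n ] ⟦ P? (f i , g j) ⟧
parity-filter-cartesianProduct P? {zero}      f g = refl
parity-filter-cartesianProduct P? {suc m} {n} f g = begin
  parity (length (filter P? (xs ++ ys)))
    ≡⟨ cong (parity ∘ length) (filter-++ P? xs ys) ⟩
  parity (length (filter P? xs ++ filter P? ys))
    ≡⟨ cong parity (length-++ (filter P? xs)) ⟩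
  parity (length (filter P? xs) ℕ.+ length (filter P? ys))
    ≡⟨ ℙ.+-homo-+ (length (filter P? xs)) _ ⟩
  parity (length (filter P? xs)) + parity (length (filter P? ys))
    ≡⟨ cong₂ _+_ (parity-filter-tabulate P? (f zero ,_) g) (parity-filter-cartesianProduct P? (f ∘ suc) g) ⟩
  ∑[ i < suc m ] ∑[ j < n ] ⟦ P? (f i , g j) ⟧ ∎
  where
  xs = map (f zero ,_) (tabulate g)
  ys = cartesianProduct (tabulate (f ∘ suc)) (tabulate g)

π-∑∑ : ∀ {n} (γ : Permutation′ n) →
  π γ ≡ ∑[ x < n ] ∑[ y < n ] (lt x y * lt (γ ⟨$⟩ʳ y) (γ ⟨$⟩ʳ x))
π-∑∑ {n} γ = trans (parity-filter-cartesianProduct inverted? {n} {n} (λ x → x) (λ y → y))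
  (∑∑-cong λ x y → ⟦⟧-× (x Fin.<? y) ((γ ⟨$⟩ʳ y) Fin.<? (γ ⟨$⟩ʳ x)))
  where
  -- A copy of the predicate local to `π`; the two agree by unfolding.
  inverted? : Decidable λ (x , y) → x Fin.< y × (γ ⟨$⟩ʳ y) Fin.< (γ ⟨$⟩ʳ x)
  inverted? (x , y) = (x Fin.<? y) ×-dec ((γ ⟨$⟩ʳ y) Fin.<? (γ ⟨$⟩ʳ x))

-- Disagreement parity of orders.

record Tournament {m : ℕ} (E : Fin m → Fin m → Parity) : Set where
  field
    irreflexive : ∀ r → E r r ≡ 0ℙ
    flip        : ∀ {r r′} → r ≢ r′ → E r′ r ≡ E r r′ ⁻¹

-- For strict total orders E and F (as 0/1-matrices), the parity of the number
-- of unordered pairs that E and F order differently.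
disagreement : ∀ {m} (E F : Fin m → Fin m → Parity) → Parity
disagreement {m} E F = ∑[ r < m ] ∑[ r′ < m ] (E r r′ * F r′ r)

p+q≡0⇒p≡q : ∀ p q → p + q ≡ 0ℙ → p ≡ q
p+q≡0⇒p≡q 0ℙ 0ℙ _ = refl
p+q≡0⇒p≡q 1ℙ 1ℙ _ = refl

-- At a pair r ≠ r′ each order gives one bit, and among three bits either none or exactly two of the
-- three pairs differ. Hence the summand `f` of the total takes equal values at (r, r′) and (r′, r),
-- and the total vanishes by `∑∑-symmetric`.
disagreement-triangle : ∀ {m} {E F G : Fin m → Fin m → Parity} → Tournament E → Tournament F → Tournament G →
  disagreement F G ≡ disagreement E F + disagreement E G
disagreement-triangle {m} {E} {F} {G} E! F! G! = p+q≡0⇒p≡q _ _ (begin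
  disagreement F G + (disagreement E F + disagreement E G)
    ≡⟨ cong (_+_ (disagreement F G)) (∑∑-distrib-+ (λ r r′ → E r r′ * F r′ r) (λ r r′ → E r r′ * G r′ r)) ⟨
  disagreement F G + ∑[ r < m ] ∑[ r′ < m ] (E r r′ * F r′ r + E r r′ * G r′ r)
    ≡⟨ ∑∑-distrib-+ (λ r r′ → F r r′ * G r′ r) (λ r r′ → E r r′ * F r′ r + E r r′ * G r′ r) ⟨
  ∑[ r < m ] ∑[ r′ < m ] f r r′
    ≡⟨ ∑∑-symmetric f diag symm ⟩
  0ℙ ∎)
  where
  open Tournament
  f : Fin m → Fin m → Parity
  f r r′ = F r r′ * G r′ r + (E r r′ * F r′ r + E r r′ * G r′ r)

  diag : ∀ r → f r r ≡ 0ℙ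
  diag r rewrite irreflexive E! r | irreflexive F! r = refl

  -- The arguments are the three bits at (r, r′); exchanging r and r′ complements all of them.
  flip-invariant : ∀ e f g → f * g ⁻¹ + (e * f ⁻¹ + e * g ⁻¹) ≡ f ⁻¹ * g + (e ⁻¹ * f + e ⁻¹ * g)
  flip-invariant 0ℙ 0ℙ 0ℙ = refl
  flip-invariant 0ℙ 0ℙ 1ℙ = refl
  flip-invariant 0ℙ 1ℙ 0ℙ = refl
  flip-invariant 0ℙ 1ℙ 1ℙ = refl
  flip-invariant 1ℙ 0ℙ 0ℙ = refl
  flip-invariant 1ℙ 0ℙ 1ℙ = refl
  flip-invariant 1ℙ 1ℙ 0ℙ = refl
  flip-invariant 1ℙ 1ℙ 1ℙ = refl

  symm : ∀ r r′ → f r r′ ≡ f r′ r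
  symm r r′ with r Fin.≟ r′
  ... | yes refl = refl
  ... | no r≢r′ rewrite flip E! r≢r′ | flip F! r≢r′ | flip G! r≢r′ =
    flip-invariant (E r r′) (F r r′) (G r r′)

disagreement-self : ∀ {m} {E : Fin m → Fin m → Parity} → Tournament E → disagreement E E ≡ 0ℙ
disagreement-self {E = E} E! = trans (disagreement-triangle E! E! E!) (ℙ.p+p≡0ℙ (disagreement E E))

-- The lexicographic order on pairs of symbols.

data Order {n} (x y : Fin n) : Parity → Parity → Parity → Parity → Set where
  less    : x ≢ y → Order x y 1ℙ 0ℙ 0ℙ 0ℙ
  equal   : x ≡ y → Order x y 0ℙ 0ℙ 1ℙ 1ℙ
  greater : x ≢ y → Order x y 0ℙ 1ℙ 0ℙ 0ℙ

-- The four indicators are indices of `Order`, so a `with` that abstracts them along with this view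
-- turns them into constants, and each case computes.
order : ∀ {n} (x y : Fin n) → Order x y (lt x y) (lt y x) (δ x y) (δ y x)
order x y with Fin.<-cmp x y
... | tri< x<y x≢y x≯y
  rewrite ⟦⟧-yes (x Fin.<? y) x<y | ⟦⟧-no (y Fin.<? x) x≯y | ⟦⟧-no (x Fin.≟ y) x≢y | ⟦⟧-no (y Fin.≟ x) (x≢y ∘ sym) = less x≢y
... | tri≈ x≮y x≡y x≯y
  rewrite ⟦⟧-no (x Fin.<? y) x≮y | ⟦⟧-no (y Fin.<? x) x≯y | ⟦⟧-yes (x Fin.≟ y) x≡y | ⟦⟧-yes (y Fin.≟ x) (sym x≡y) = equal x≡y
... | tri> x≮y x≢y x>y
  rewrite ⟦⟧-no (x Fin.<? y) x≮y | ⟦⟧-yes (y Fin.<? x) x>y | ⟦⟧-no (x Fin.≟ y) x≢y | ⟦⟧-no (y Fin.≟ x) (x≢y ∘ sym) = greater x≢y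

lex : ∀ {n} → Fin n × Fin n → Fin n × Fin n → Parity
lex (s , x) (s′ , x′) = lt s s′ + δ s s′ * lt x x′

lex-irreflexive : ∀ {n} (p : Fin n × Fin n) → lex p p ≡ 0ℙ
lex-irreflexive (s , x)
  rewrite ⟦⟧-no (s Fin.<? s) (Fin.<-irrefl refl) | ⟦⟧-no (x Fin.<? x) (Fin.<-irrefl refl) = ℙ.*-zeroʳ (δ s s)

lex-flip : ∀ {n} {p q : Fin n × Fin n} → p ≢ q → lex q p ≡ lex p q ⁻¹
lex-flip {p = s , x} {t , y} p≢q
  with lt s t | lt t s | δ s t | δ t s | order s t | lt x y | lt y x | δ x y | δ y x | order x y
... | _ | _ | _ | _ | less _     | _ | _ | _ | _ | _         = refl
... | _ | _ | _ | _ | greater _  | _ | _ | _ | _ | _         = refl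
... | _ | _ | _ | _ | equal refl | _ | _ | _ | _ | less _     = refl
... | _ | _ | _ | _ | equal refl | _ | _ | _ | _ | greater _  = refl
... | _ | _ | _ | _ | equal refl | _ | _ | _ | _ | equal refl = contradiction refl p≢q

-- The second factor compares in the reverse direction, so for s ≠ t one of the factors is 0. Two
-- such orders thus disagree only where the first coordinates coincide, and there exactly at
-- inversions.
lex-*-lex : ∀ {n} (s t x y u v : Fin n) →
  lex (s , x) (t , y) * lex (t , v) (s , u) ≡ δ s t * (lt x y * lt v u)
lex-*-lex s t x y u v with lt s t | lt t s | δ s t | δ t s | order s t
... | _ | _ | _ | _ | less _    = refl
... | _ | _ | _ | _ | equal _   = refl
... | _ | _ | _ | _ | greater _ = refl

-- The disagreement of row-major and column-major order on the cells of an n by n grid, that is, the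
-- parity of the permutation (s, x) ↦ (x, s).
transposition : ℕ → Parity
transposition n =
  ∑[ s < n ] ∑[ x < n ] ∑[ t < n ] ∑[ y < n ] (lex (s , x) (t , y) * lex (y , t) (x , s))

-- Row orders of an orthogonal array.

module _ {k n : ℕ} (A : OA k n) where

  coords : Fin k → Fin k → Fin (n ^ 2) → Fin n × Fin n
  coords i j r = entry (proj₁ A) r i , entry (proj₁ A) r j

  rowOrder : Fin k → Fin k → Fin (n ^ 2) → Fin (n ^ 2) → Parity
  rowOrder i j r r′ = lex (coords i j r) (coords i j r′)

  module _ {i j : Fin k} (i≢j : i ≢ j) where

    coords-rowAt : ∀ s x → coords i j (rowAt A i j i≢j s x) ≡ (s , x)
    coords-rowAt s x with _ , (ri≡s , rj≡x) , _ ← proj₂ A i j i≢j s x = cong₂ _,_ ri≡s rj≡x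

    rowAt-coords : ∀ r → uncurry (rowAt A i j i≢j) (coords i j r) ≡ r
    rowAt-coords r = proj₂ (proj₂ (proj₂ A i j i≢j _ _)) (refl , refl)

    -- Rows correspond bijectively to their pairs of symbols in columns i and j, which is the
    -- defining property of an orthogonal array.
    ∑-rows : ∀ f → sum f ≡ ∑[ s < n ] ∑[ x < n ] f (rowAt A i j i≢j s x)
    ∑-rows f = ∑∑-reindex f (rowAt A i j i≢j) (coords i j) rowAt-coords coords-rowAt

    ∑∑-rows : ∀ f → ∑[ r < n ^ 2 ] ∑[ r′ < n ^ 2 ] f r r′ ≡
      ∑[ s < n ] ∑[ x < n ] ∑[ t < n ] ∑[ y < n ] f (rowAt A i j i≢j s x) (rowAt A i j i≢j t y)
    ∑∑-rows f = trans (∑-rows (sum ∘ f)) (∑∑-cong λ s x → ∑-rows (f (rowAt A i j i≢j s x)))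

    -- Rows with the same symbols in columns i and j are equal, so distinct rows are never tied.
    rowOrder-tournament : Tournament (rowOrder i j)
    rowOrder-tournament = record
      { irreflexive = lex-irreflexive ∘ coords i j
      ; flip        = λ r≢r′ → lex-flip λ eq →
          r≢r′ (trans (sym (rowAt-coords _)) (trans (cong (uncurry (rowAt A i j i≢j)) eq) (rowAt-coords _)))
      }

    -- The row with (s, x) in columns i and j has (x, s) in columns j and i, so indexing rows by (s,
    -- x) removes the array from the formula.
    disagreement-swap : disagreement (rowOrder i j) (rowOrder j i) ≡ transposition n
    disagreement-swap = trans (∑∑-rows λ r r′ → rowOrder i j r r′ * rowOrder j i r′ r)
      (∑∑-cong λ s x → ∑∑-cong λ t y → cong₂ swapped (coords-rowAt s x) (coords-rowAt t y))
      where
      swapped : Fin n × Fin n → Fin n × Fin n → Parity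
      swapped (s , x) (t , y) = lex (s , x) (t , y) * lex (y , t) (x , s)

  τ≡disagreement : ∀ {c i j} c≢i c≢j i≢j →
    τ A (triple c i j c≢i c≢j i≢j) ≡ disagreement (rowOrder c i) (rowOrder c j)
  τ≡disagreement {c} {i} {j} c≢i c≢j i≢j = begin
    τ A (triple c i j c≢i c≢j i≢j)
      ≡⟨ sum-cong-≗ (λ s → π-∑∑ (ρ A s (triple c i j c≢i c≢j i≢j))) ⟩
    ∑[ s < n ] ∑[ x < n ] ∑[ y < n ] inversion s x s y
      -- The permutations `ρ` only compare rows with the same symbol s in column c. A second symbol
      -- t, tied to s by `δ s t`, extends the sum to all pairs of rows.
      ≡⟨ ∑∑-cong (λ s x → ∑-δ s (λ t → ∑[ y < n ] inversion s x t y)) ⟨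
    ∑[ s < n ] ∑[ x < n ] ∑[ t < n ] (δ s t * ∑[ y < n ] inversion s x t y)
      ≡⟨ ∑∑-cong (λ s x → sum-cong-≗ λ t → *-distribˡ-sum (δ s t) (inversion s x t)) ⟩
    ∑[ s < n ] ∑[ x < n ] ∑[ t < n ] ∑[ y < n ] (δ s t * inversion s x t y)
      ≡⟨ ∑∑-cong (λ s x → ∑∑-cong λ t y → pointwise s x t y) ⟨
    ∑[ s < n ] ∑[ x < n ] ∑[ t < n ] ∑[ y < n ]
      (rowOrder c i (row s x) (row t y) * rowOrder c j (row t y) (row s x))
      ≡⟨ ∑∑-rows c≢i (λ r r′ → rowOrder c i r r′ * rowOrder c j r′ r) ⟨
    disagreement (rowOrder c i) (rowOrder c j) ∎
    where
    row : Fin n → Fin n → Fin (n ^ 2)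
    row = rowAt A c i c≢i

    image : Fin n → Fin n → Fin n
    image s x = entry (proj₁ A) (row s x) j

    inversion : Fin n → Fin n → Fin n → Fin n → Parity
    inversion s x t y = lt x y * lt (image t y) (image s x)

    coords-image : ∀ s x → coords c j (row s x) ≡ (s , image s x)
    coords-image s x = cong (_, image s x) (cong proj₁ (coords-rowAt c≢i s x))

    pointwise : ∀ s x t y →
      rowOrder c i (row s x) (row t y) * rowOrder c j (row t y) (row s x) ≡ δ s t * inversion s x t y
    pointwise s x t y = trans
      (cong₂ _*_ (cong₂ lex (coords-rowAt c≢i s x) (coords-rowAt c≢i t y))
                 (cong₂ lex (coords-image t y) (coords-image s x)))
      (lex-*-lex s t x y (image s x) (image t y))

-- Unordered pairs of columns.

increasingPairs : ∀ k → List (Fin k × Fin k)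
increasingPairs zero    = []
increasingPairs (suc k) =
  map (λ b → zero , suc b) (allFin k) ++ map (λ (a , b) → suc a , suc b) (increasingPairs k)

∈-increasingPairs : ∀ {k} {a b : Fin k} → a Fin.< b → (a , b) ∈ increasingPairs k
∈-increasingPairs {a = zero}  {suc b} _         = ∈-++⁺ˡ (∈-map⁺ _ (∈-allFin b))
∈-increasingPairs {a = suc a} {suc b} (s<s a<b) = ∈-++⁺ʳ _ (∈-map⁺ _ (∈-increasingPairs a<b))

-- For k ≥ 2 this drops the pair (0 , 1).
freePairs : ∀ k → List (Fin k × Fin k)
freePairs k = drop 1 (increasingPairs k)

length-increasingPairs : ∀ k → length (increasingPairs k) ≡ k C 2
length-increasingPairs zero    = refl
length-increasingPairs (suc k) = begin
  length (xs ++ ys)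
    ≡⟨ length-++ xs ⟩
  length xs ℕ.+ length ys
    ≡⟨ cong₂ ℕ._+_ (trans (length-map _ (allFin k)) (length-tabulate _)) (length-map _ (increasingPairs k)) ⟩
  k ℕ.+ length (increasingPairs k)
    ≡⟨ cong₂ ℕ._+_ (sym (ℕ.nC1≡n k)) (length-increasingPairs k) ⟩
  k C 1 ℕ.+ k C 2
    ≡⟨ ℕ.nCk+nC[k+1]≡[n+1]C[k+1] k 1 ⟩
  suc k C 2 ∎
  where
  xs = map (λ b → zero , suc b) (allFin k)
  ys = map (λ (a , b) → suc a , suc b) (increasingPairs k)

-- The bits h(a, b), and the code of an array.

toFin : Parity → Fin 2
toFin 0ℙ = zero
toFin 1ℙ = suc zero

toFin-injective : ∀ p q → toFin p ≡ toFin q → p ≡ q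
toFin-injective 0ℙ 0ℙ _ = refl
toFin-injective 1ℙ 1ℙ _ = refl

module _ {k n : ℕ} where

  -- This is h(a, b). Writing the number of columns as 2 + k makes the base columns 0 and 1
  -- available.
  potential : OA (2 ℕ.+ k) n → Fin (2 ℕ.+ k) → Fin (2 ℕ.+ k) → Parity
  potential A a b = disagreement (rowOrder A zero (suc zero)) (rowOrder A a b)

  module _ (A : OA (2 ℕ.+ k) n) where

    base-tournament : Tournament (rowOrder A zero (suc zero))
    base-tournament = rowOrder-tournament A λ ()

    potential-base : potential A zero (suc zero) ≡ 0ℙ
    potential-base = disagreement-self base-tournament

    -- By the triangle law the sum is d(L_ab, L_ba), which is the same for all arrays.
    potential-swap : ∀ {a b} → a ≢ b → potential A a b + potential A b a ≡ transposition n
    potential-swap a≢b = trans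
      (sym (disagreement-triangle base-tournament (rowOrder-tournament A a≢b) (rowOrder-tournament A (a≢b ∘ sym))))
      (disagreement-swap A a≢b)

    τ≡potential : ∀ {c i j} c≢i c≢j i≢j →
      τ A (triple c i j c≢i c≢j i≢j) ≡ potential A c i + potential A c j
    τ≡potential c≢i c≢j i≢j = trans (τ≡disagreement A c≢i c≢j i≢j)
      (disagreement-triangle base-tournament (rowOrder-tournament A c≢i) (rowOrder-tournament A c≢j))

  module _ (A B : OA (2 ℕ.+ k) n)
    (free : ∀ {p} → p ∈ freePairs (2 ℕ.+ k) → uncurry (potential A) p ≡ uncurry (potential B) p) where

    potential-≡-< : ∀ {a b} → a Fin.< b → potential A a b ≡ potential B a b
    potential-≡-< a<b = increasing (∈-increasingPairs a<b)
      where
      increasing : ∀ {p} → p ∈ increasingPairs (2 ℕ.+ k) → uncurry (potential A) p ≡ uncurry (potential B) p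
      -- With at least two columns the head of the list is the base pair (0, 1), where both
      -- potentials are 0.
      increasing (here refl) = trans (potential-base A) (sym (potential-base B))
      increasing (there p∈)  = free p∈

    potential-≡ : ∀ {a b} → a ≢ b → potential A a b ≡ potential B a b
    potential-≡ {a} {b} a≢b with Fin.<-cmp a b
    ... | tri< a<b _ _ = potential-≡-< a<b
    ... | tri≈ _ a≡b _ = contradiction a≡b a≢b
    -- The sum h(b, a) + h(a, b) is common to both arrays, and so is h(b, a) since b < a; cancelling
    -- it leaves h(a, b).
    ... | tri> _ _ b<a = ℙ.+-cancelˡ-≡ (potential A b a) _ _ (begin
      potential A b a + potential A a b ≡⟨ potential-swap A (a≢b ∘ sym) ⟩
      transposition n                   ≡⟨ potential-swap B (a≢b ∘ sym) ⟨
      potential B b a + potential B a b ≡⟨ cong (_+ potential B a b) (potential-≡-< b<a) ⟨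
      potential A b a + potential B a b ∎)

    τ-≈ : τ A ≈ τ B
    τ-≈ (triple c i j c≢i c≢j i≢j) = begin
      τ A (triple c i j c≢i c≢j i≢j)    ≡⟨ τ≡potential A c≢i c≢j i≢j ⟩
      potential A c i + potential A c j ≡⟨ cong₂ _+_ (potential-≡ c≢i) (potential-≡ c≢j) ⟩
      potential B c i + potential B c j ≡⟨ τ≡potential B c≢i c≢j i≢j ⟨
      τ B (triple c i j c≢i c≢j i≢j)    ∎

  -- Bits take values in `Fin 2` so that `funToFin` can number all bit vectors by a power of 2.
  bits : OA (2 ℕ.+ k) n → Fin (length (freePairs (2 ℕ.+ k))) → Fin 2
  bits A = toFin ∘ uncurry (potential A) ∘ lookup (freePairs (2 ℕ.+ k))

  code : OA (2 ℕ.+ k) n → Fin (2 ^ length (freePairs (2 ℕ.+ k)))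
  code A = funToFin (bits A)

  code-determines-τ : ∀ A B → code A ≡ code B → τ A ≈ τ B
  code-determines-τ A B eq = τ-≈ A B λ {p} p∈ →
    subst (λ p → uncurry (potential A) p ≡ uncurry (potential B) p) (sym (lookup-index p∈))
      (toFin-injective _ _ (begin
        bits A (Any.index p∈)            ≡⟨ Fin.finToFun-funToFin (bits A) (Any.index p∈) ⟨
        finToFun (code A) (Any.index p∈) ≡⟨ cong (λ c → finToFun c (Any.index p∈)) eq ⟩
        finToFun (code B) (Any.index p∈) ≡⟨ Fin.finToFun-funToFin (bits B) (Any.index p∈) ⟩
        bits B (Any.index p∈)            ∎))

-- Counting τ-parities and taking logarithms.

AllPairs-lookup : ∀ {A : Set} {R : Rel A 0ℓ} {xs} → AllPairs R xs →
  ∀ {i j} → i Fin.< j → R (lookup xs i) (lookup xs j)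
AllPairs-lookup {xs = _ ∷ xs} (rs ∷ _)  {zero}  {suc j} _         = All.lookup rs (∈-lookup j)
AllPairs-lookup               (_ ∷ rss) {suc i} {suc j} (s<s i<j) = AllPairs-lookup rss i<j

-- Pigeonhole: with more than M survivors, two of them would have preimages with the same value of
-- `g`, hence be related, but `deduplicate` leaves pairwise unrelated elements.
length-deduplicate-map-≤ : ∀ {A : Set} (S : DecSetoid 0ℓ 0ℓ) (let open DecSetoid S using (Carrier) renaming (_≈_ to _∼_; _≟_ to _∼?_))
  (f : A → Carrier) {M} (g : A → Fin M) → (∀ x y → g x ≡ g y → f x ∼ f y) →
  ∀ xs → length (deduplicate _∼?_ (map f xs)) ℕ.≤ M
length-deduplicate-map-≤ {A} S f g g-determines-f xs = ℕ.≮⇒≥ λ M<length →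
  let i , j , i<j , gi≡gj = Fin.pigeonhole M<length (g ∘ proj₁ ∘ preimage)
      x , fx = preimage i
      y , fy = preimage j
  in AllPairs-lookup (deduplicate-! S (map f xs)) i<j
       (subst₂ _∼_ (sym fx) (sym fy) (g-determines-f x y gi≡gj))
  where
  open DecSetoid S using () renaming (_≈_ to _∼_; _≟_ to _∼?_)
  ys = deduplicate _∼?_ (map f xs)

  preimage : ∀ i → ∃ λ x → lookup ys i ≡ f x
  preimage i with x , _ , eq ← ∈-map⁻ f (∈-deduplicate⁻ _∼?_ (map f xs) (∈-lookup i)) = x , eq

τ-decSetoid : ℕ → DecSetoid 0ℓ 0ℓ
τ-decSetoid k = record
  { Carrier          = TauParity k
  ; _≈_              = _≈_
  ; isDecEquivalence = record
    { isEquivalence = record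
      { refl  = λ _ → refl
      ; sym   = λ f≈g t → sym (f≈g t)
      ; trans = λ f≈g g≈h t → trans (f≈g t) (g≈h t)
      }
    ; _≟_ = _≈?_
    }
  }

-- For q = a / d with a ≥ 0, having m d ≤ a would give N ^ d ≤ 2 ^ (m d) ≤ 2 ^ a, against the cut
-- condition. A negative q lies below m since m ≥ 0.
log₂-2^ : ∀ {N} m → N ℕ.≤ 2 ^ m → log₂ N ≤ᴸ fromℤ (+ m)
log₂-2^ {N} m N≤2^m {q} q<log₂N =
  -- For a variable m the quotient `+ m ℚ./ 1` does not reduce; it is replaced by the explicit
  -- fraction `m/1`, whose numerator and denominator compute.
  subst (q ℚ.<_) (sym (ℚ.↥p/↧p≡p m/1))
    (*<* (subst (ℤ._< + m ℤ.* ℚ.↧ q) (sym (ℤ.*-identityʳ (ℚ.↥ q))) (↥q<m*↧q q q<log₂N)))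
  where
  m/1 : ℚ
  m/1 = mkℚ (+ m) 0 (Coprimality.sym (Coprimality.1-coprimeTo m))

  ↥q<m*↧q : ∀ q → log₂ N q → ℚ.↥ q ℤ.< + m ℤ.* ℚ.↧ q
  ↥q<m*↧q (mkℚ (+ a) d-1 _) 2^a<N^d = subst (+ a ℤ.<_) (ℤ.pos-* m d) (ℤ.+<+ (ℕ.≰⇒> λ m*d≤a →
    ℕ.<⇒≱ 2^a<N^d (ℕ.≤-trans (ℕ.^-monoˡ-≤ d N≤2^m)
      (ℕ.≤-trans (ℕ.≤-reflexive (ℕ.^-*-assoc 2 m d)) (ℕ.^-monoʳ-≤ 2 m*d≤a)))))
    where d = suc d-1
  ↥q<m*↧q (mkℚ ℤ.-[1+ a ] d-1 _) _ = subst (ℤ.-[1+ a ] ℤ.<_) (ℤ.pos-* m (suc d-1)) ℤ.-<+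

corollary4p3 : (k n : ℕ) → k ≥ 3 → n ≥ 2 → 𝓑 k n ≤ᴸ fromℤ (+ (k C 2) - + 1)
corollary4p3 (suc zero)    _ (s≤s ()) _
corollary4p3 (suc (suc k)) n _        _ =
  -- As `increasingPairs` begins with (0, 1), its length is definitionally one more than that of
  -- `freePairs`, so the subtraction of 1 computes away.
  subst (λ c → 𝓑 (2 ℕ.+ k) n ≤ᴸ fromℤ (+ c - + 1)) (length-increasingPairs (2 ℕ.+ k))
    (λ {q} → log₂-2^ (length (freePairs (2 ℕ.+ k))) #τ-parities≤ {q})
  where
  #τ-parities≤ : #τ-parities (2 ℕ.+ k) n ℕ.≤ 2 ^ length (freePairs (2 ℕ.+ k))
  #τ-parities≤ =
    length-deduplicate-map-≤ (τ-decSetoid (2 ℕ.+ k)) τ code code-determines-τ (orthogonalArrays (2 ℕ.+ k) n)
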